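{- For $n\ge 0$ let \[ a_n:= \sum_{k=0}^{\lfloor n/3\rfloor}\binom{2n-3k}{n}. \] Then for every integer $n\ge 3$, \[ 3(n+1)(7n-2)a_n -6(7n+5)(2n-1)a_{n-1} +(n+1)(7n-2)a_{n-2} -2(7n+5)(2n-1)a_{n-3}=0. \] -}

module Defs where

open import Data.List using (map; upTo)
open import Data.Nat using (ℕ; suc; _*_; _∸_; _/_)
open import Data.Nat.Combinatorics using (_C_)
open import Data.Nat.ListAction using (sum)

-- For k ≤ n / 3 we have 3 * k ≤ n ≤ 2 * n, so the truncated subtraction
-- is the ordinary one.
a : ℕ → ℕ
a n = sum (map (λ k → (2 * n ∸ 3 * k) C n) (upTo (suc (n / 3))))

{-# OPTIONS --safe #-}
module Submission where

-- Put s N m = C(N,m) + C(N-3,m) + C(N-6,m) + ..., the sum running over the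
-- nonnegative upper indices, so that a n = s (2n) n.  Two facts determine s:
-- it obeys Pascal's rule s (N+1) (m+1) = s N m + s N (m+1), and by
-- construction s (N+3) m - s N m = C(N+3,m).  Expanding s (N+3) (m+3) three
-- times by Pascal's rule turns the latter into
--   3 s (N+1) (m+2) + s N m = C(N+3,m+3)   (s-relation),
-- the shadow of the identity (1+y)^3 - 1 = 3y(1+y) + y^3.  Take N = 2n-1 and
-- m = n-2, and use s (2n-1) (n-2) = C(2n-1,n-2) + s (2n-4) (n-2), to get
--   3 a(n) + a(n-2) = C(2n+2,n+1) - C(2n-1,n-2)   (a-pair),
-- whose right side is a rational function of n times the central binomial
-- coefficient:
--   2(n+1) (3 a(n) + a(n-2)) = (7n+5) C(2n,n)   (a-pair-closed).
--
-- The left side of the asserted recurrence is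
--   (n+1)(7n-2) (3 a(n) + a(n-2)) - 2(7n+5)(2n-1) (3 a(n-1) + a(n-3)),
-- so it vanishes by the closed form at n and at n-1, together with the
-- recurrence n C(2n,n) = 2(2n-1) C(2n-2,n-1)   (central-step).

open import Defs
open import Data.Nat using (ℕ; _≤_; _∸_)
open import Data.Integer using (ℤ; +_; _+_; _-_; _*_)
open import Relation.Binary.PropositionalEquality using (_≡_)

open import Data.Integer.Properties using (pos-*; i≡j⇒i-j≡0)
import Data.Integer.Tactic.RingSolver as ℤ-Solver
open import Data.List using (applyUpTo; _∷_)
open import Data.List.Properties using (map-upTo)
-- Circled operators are those of ℕ; the plain ones are those of ℤ.
open import Data.Nat using (zero; suc; _<_; _/_; z≤n; s≤s)
  renaming (_+_ to _⊕_; _*_ to _⊛_)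
open import Data.Nat.Combinatorics
  using (_C_; nCk≡nC[n∸k]; k>n⇒nCk≡0; nCk+nC[k+1]≡[n+1]C[k+1])
open import Data.Nat.DivMod using (m≡m%n+[m/n]*n; m%n<n; m/n*n≤m)
open import Data.Nat.ListAction using (sum)
open import Data.Nat.Properties
  using ( ≤-trans; m≤m+n; m≤n+m; m+n∸m≡n; +-identityʳ; +-assoc; +-comm
        ; +-cancelˡ-≡; +-cancelʳ-≡; +-monoˡ-<; *-zeroʳ; *-suc; *-distribˡ-+; *-cancelˡ-≡)
open import Data.Nat.Tactic.RingSolver using (solve-∀)
open import Relation.Binary.PropositionalEquality
  using (refl; sym; trans; cong; cong₂; subst; subst₂; module ≡-Reasoning)

-- Binomial coefficients

absorption : ∀ n k → suc k ⊛ (suc n C suc k) ≡ suc n ⊛ (n C k)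
absorption zero    zero    = refl
absorption zero    (suc k) = begin
  suc (suc k) ⊛ (1 C suc (suc k)) ≡⟨ cong (suc (suc k) ⊛_) (k>n⇒nCk≡0 {1} {suc (suc k)} (s≤s (s≤s z≤n))) ⟩
  suc (suc k) ⊛ 0                 ≡⟨ *-zeroʳ (suc (suc k)) ⟩
  0                               ≡⟨ cong (1 ⊛_) (k>n⇒nCk≡0 {0} {suc k} (s≤s z≤n)) ⟨
  1 ⊛ (0 C suc k)                 ∎
  where open ≡-Reasoning
absorption (suc n) zero    = begin
  1 ⊛ (suc (suc n) C 1)                 ≡⟨ cong (1 ⊛_) (nCk+nC[k+1]≡[n+1]C[k+1] (suc n) 0) ⟨
  1 ⊛ ((suc n C 0) ⊕ (suc n C 1))       ≡⟨ *-distribˡ-+ 1 (suc n C 0) (suc n C 1) ⟩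
  1 ⊕ 1 ⊛ (suc n C 1)                   ≡⟨ cong (1 ⊕_) (absorption n 0) ⟩
  suc (suc n) ⊛ (suc n C 0)             ∎
  where open ≡-Reasoning
absorption (suc n) (suc k) = begin
  suc (suc k) ⊛ (suc (suc n) C suc (suc k))
    ≡⟨ cong (suc (suc k) ⊛_) (nCk+nC[k+1]≡[n+1]C[k+1] (suc n) (suc k)) ⟨
  suc (suc k) ⊛ (p ⊕ (suc n C suc (suc k)))
    ≡⟨ expand k p (suc n C suc (suc k)) ⟩
  p ⊕ suc k ⊛ p ⊕ suc (suc k) ⊛ (suc n C suc (suc k))
    ≡⟨ cong₂ (λ u v → p ⊕ u ⊕ v) (absorption n k) (absorption n (suc k)) ⟩
  p ⊕ suc n ⊛ (n C k) ⊕ suc n ⊛ (n C suc k)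
    ≡⟨ collect n p (n C k) (n C suc k) ⟩
  p ⊕ suc n ⊛ ((n C k) ⊕ (n C suc k))
    ≡⟨ cong (λ u → p ⊕ suc n ⊛ u) (nCk+nC[k+1]≡[n+1]C[k+1] n k) ⟩
  suc (suc n) ⊛ p ∎
  where
  open ≡-Reasoning
  p = suc n C suc k
  expand : ∀ k p q → suc (suc k) ⊛ (p ⊕ q) ≡ p ⊕ suc k ⊛ p ⊕ suc (suc k) ⊛ q
  expand = solve-∀
  collect : ∀ n p q r → p ⊕ suc n ⊛ q ⊕ suc n ⊛ r ≡ p ⊕ suc n ⊛ (q ⊕ r)
  collect = solve-∀

-- The two middle entries of an odd row of Pascal's triangle agree.
odd-row-middle : ∀ m → (1 ⊕ 2 ⊛ m) C suc m ≡ (1 ⊕ 2 ⊛ m) C m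
odd-row-middle m = trans (nCk≡nC[n∸k] (s≤s (m≤m+n m (m ⊕ 0))))
  (cong ((1 ⊕ 2 ⊛ m) C_) (trans (m+n∸m≡n m (m ⊕ 0)) (+-identityʳ m)))

central-half : ∀ m → (2 ⊕ 2 ⊛ m) C suc m ≡ 2 ⊛ ((1 ⊕ 2 ⊛ m) C m)
central-half m = begin
  (2 ⊕ 2 ⊛ m) C suc m ≡⟨ nCk+nC[k+1]≡[n+1]C[k+1] (1 ⊕ 2 ⊛ m) m ⟨
  x ⊕ ((1 ⊕ 2 ⊛ m) C suc m) ≡⟨ cong (x ⊕_) (odd-row-middle m) ⟩
  x ⊕ x               ≡⟨ cong (x ⊕_) (+-identityʳ x) ⟨
  2 ⊛ x               ∎
  where
  open ≡-Reasoning
  x = (1 ⊕ 2 ⊛ m) C m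

central-step : ∀ m →
  suc m ⊛ ((2 ⊕ 2 ⊛ m) C suc m) ≡ 2 ⊛ ((1 ⊕ 2 ⊛ m) ⊛ ((2 ⊛ m) C m))
central-step m = begin
  suc m ⊛ ((2 ⊕ 2 ⊛ m) C suc m)         ≡⟨ cong (suc m ⊛_) (central-half m) ⟩
  suc m ⊛ (2 ⊛ x)                       ≡⟨ swap (suc m) x ⟩
  2 ⊛ (suc m ⊛ x)                       ≡⟨ cong (λ u → 2 ⊛ (suc m ⊛ u)) (odd-row-middle m) ⟨
  2 ⊛ (suc m ⊛ ((1 ⊕ 2 ⊛ m) C suc m))   ≡⟨ cong (2 ⊛_) (absorption (2 ⊛ m) m) ⟩
  2 ⊛ ((1 ⊕ 2 ⊛ m) ⊛ ((2 ⊛ m) C m))     ∎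
  where
  open ≡-Reasoning
  x = (1 ⊕ 2 ⊛ m) C m
  swap : ∀ p q → p ⊛ (2 ⊛ q) ≡ 2 ⊛ (p ⊛ q)
  swap = solve-∀

-- The ratio of the entries next to and at the middle of an odd row.
odd-row-ratio : ∀ j →
  suc j ⊛ ((3 ⊕ 2 ⊛ j) C suc j) ≡ (3 ⊕ j) ⊛ ((3 ⊕ 2 ⊛ j) C j)
odd-row-ratio j = +-cancelˡ-≡ (suc j ⊛ x) _ _ (begin
  suc j ⊛ x ⊕ suc j ⊛ y       ≡⟨ *-distribˡ-+ (suc j) x y ⟨
  suc j ⊛ (x ⊕ y)             ≡⟨ cong (suc j ⊛_) (nCk+nC[k+1]≡[n+1]C[k+1] (3 ⊕ 2 ⊛ j) j) ⟩
  suc j ⊛ ((4 ⊕ 2 ⊛ j) C suc j) ≡⟨ absorption (3 ⊕ 2 ⊛ j) j ⟩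
  (4 ⊕ 2 ⊛ j) ⊛ x             ≡⟨ split j x ⟩
  suc j ⊛ x ⊕ (3 ⊕ j) ⊛ x     ∎)
  where
  open ≡-Reasoning
  x = (3 ⊕ 2 ⊛ j) C j
  y = (3 ⊕ 2 ⊛ j) C suc j
  split : ∀ j x → (4 ⊕ 2 ⊛ j) ⊛ x ≡ suc j ⊛ x ⊕ (3 ⊕ j) ⊛ x
  split = solve-∀

-- Column sums of Pascal's triangle in steps of three

-- s N m is the sum of i C m over all i ≤ N congruent to N modulo 3.
s : ℕ → ℕ → ℕ
s (suc (suc (suc N))) m = ((3 ⊕ N) C m) ⊕ s N m
s N                   m = N C m

s-pascal : ∀ N m → s N m ⊕ s N (suc m) ≡ s (suc N) (suc m)
s-pascal zero             m = nCk+nC[k+1]≡[n+1]C[k+1] 0 m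
s-pascal (suc zero)       m = nCk+nC[k+1]≡[n+1]C[k+1] 1 m
-- Only here does s gain a summand with no partner below, namely 0 C (m+1) = 0.
s-pascal (suc (suc zero)) m = begin
  (2 C m) ⊕ (2 C suc m)       ≡⟨ nCk+nC[k+1]≡[n+1]C[k+1] 2 m ⟩
  3 C suc m                   ≡⟨ +-identityʳ (3 C suc m) ⟨
  (3 C suc m) ⊕ 0             ≡⟨ cong ((3 C suc m) ⊕_) (k>n⇒nCk≡0 {0} {suc m} (s≤s z≤n)) ⟨
  (3 C suc m) ⊕ (0 C suc m)   ∎
  where open ≡-Reasoning
s-pascal (suc (suc (suc N))) m = begin
  (p ⊕ s N m) ⊕ (q ⊕ s N (suc m)) ≡⟨ interchange p (s N m) q (s N (suc m)) ⟩
  (p ⊕ q) ⊕ (s N m ⊕ s N (suc m))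
    ≡⟨ cong₂ _⊕_ (nCk+nC[k+1]≡[n+1]C[k+1] (3 ⊕ N) m) (s-pascal N m) ⟩
  ((4 ⊕ N) C suc m) ⊕ s (suc N) (suc m) ∎
  where
  open ≡-Reasoning
  p = (3 ⊕ N) C m
  q = (3 ⊕ N) C suc m
  interchange : ∀ w x y z → (w ⊕ x) ⊕ (y ⊕ z) ≡ (w ⊕ y) ⊕ (x ⊕ z)
  interchange = solve-∀

s-vanishes : ∀ N {m} → N < m → s N m ≡ 0
s-vanishes zero                lt = k>n⇒nCk≡0 lt
s-vanishes (suc zero)          lt = k>n⇒nCk≡0 lt
s-vanishes (suc (suc zero))    lt = k>n⇒nCk≡0 lt
s-vanishes (suc (suc (suc N))) lt =
  cong₂ _⊕_ (k>n⇒nCk≡0 lt) (s-vanishes N (≤-trans (s≤s (m≤n+m N 3)) lt))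

-- The two ways of computing s (N+3) (m+3) - s N (m+3).
s-relation : ∀ N m → 3 ⊛ s (1 ⊕ N) (2 ⊕ m) ⊕ s N m ≡ (3 ⊕ N) C (3 ⊕ m)
s-relation N m = +-cancelʳ-≡ x₃ _ _ (begin
  3 ⊛ s (1 ⊕ N) (2 ⊕ m) ⊕ x₀ ⊕ x₃ ≡⟨ cong (λ u → 3 ⊛ u ⊕ x₀ ⊕ x₃) (s-pascal N (1 ⊕ m)) ⟨
  3 ⊛ (x₁ ⊕ x₂) ⊕ x₀ ⊕ x₃         ≡⟨ binomial x₀ x₁ x₂ x₃ ⟩
  ((x₀ ⊕ x₁) ⊕ (x₁ ⊕ x₂)) ⊕ ((x₁ ⊕ x₂) ⊕ (x₂ ⊕ x₃))
    ≡⟨ cong₂ _⊕_ (cong₂ _⊕_ (s-pascal N m) (s-pascal N (1 ⊕ m)))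
                 (cong₂ _⊕_ (s-pascal N (1 ⊕ m)) (s-pascal N (2 ⊕ m))) ⟩
  (s (1 ⊕ N) (1 ⊕ m) ⊕ s (1 ⊕ N) (2 ⊕ m)) ⊕ (s (1 ⊕ N) (2 ⊕ m) ⊕ s (1 ⊕ N) (3 ⊕ m))
    ≡⟨ cong₂ _⊕_ (s-pascal (1 ⊕ N) (1 ⊕ m)) (s-pascal (1 ⊕ N) (2 ⊕ m)) ⟩
  s (2 ⊕ N) (2 ⊕ m) ⊕ s (2 ⊕ N) (3 ⊕ m) ≡⟨ s-pascal (2 ⊕ N) (2 ⊕ m) ⟩
  ((3 ⊕ N) C (3 ⊕ m)) ⊕ x₃        ∎)
  where
  open ≡-Reasoning
  x₀ = s N m
  x₁ = s N (1 ⊕ m)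
  x₂ = s N (2 ⊕ m)
  x₃ = s N (3 ⊕ m)
  binomial : ∀ x₀ x₁ x₂ x₃ → 3 ⊛ (x₁ ⊕ x₂) ⊕ x₀ ⊕ x₃
    ≡ ((x₀ ⊕ x₁) ⊕ (x₁ ⊕ x₂)) ⊕ ((x₁ ⊕ x₂) ⊕ (x₂ ⊕ x₃))
  binomial = solve-∀

-- The first k+1 summands exhaust s N m if all have a nonnegative upper index
-- and the next upper index lies below m.
sum-is-s : ∀ k N m → k ⊛ 3 ≤ N → N < (suc k ⊛ 3) ⊕ m →
  sum (applyUpTo (λ i → (N ∸ 3 ⊛ i) C m) (suc k)) ≡ s N m
sum-is-s zero    zero                m _ _ = +-identityʳ (0 C m)
sum-is-s zero    (suc zero)          m _ _ = +-identityʳ (1 C m)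
sum-is-s zero    (suc (suc zero))    m _ _ = +-identityʳ (2 C m)
sum-is-s zero    (suc (suc (suc N))) m _ (s≤s (s≤s (s≤s lt))) =
  cong (((3 ⊕ N) C m) ⊕_) (sym (s-vanishes N lt))
sum-is-s (suc k) (suc (suc (suc N))) m (s≤s (s≤s (s≤s le))) (s≤s (s≤s (s≤s lt))) =
  cong (((3 ⊕ N) C m) ⊕_)
    (trans (cong sum (applyUpTo-cong shift (suc k))) (sum-is-s k N m le lt))
  where
  shift : ∀ i → (3 ⊕ N ∸ 3 ⊛ suc i) C m ≡ (N ∸ 3 ⊛ i) C m
  shift i = cong (λ t → (3 ⊕ N ∸ t) C m) (*-suc 3 i)
  applyUpTo-cong : ∀ {f g : ℕ → ℕ} → (∀ i → f i ≡ g i) → ∀ l → applyUpTo f l ≡ applyUpTo g l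
  applyUpTo-cong f≗g zero    = refl
  applyUpTo-cong f≗g (suc l) = cong₂ _∷_ (f≗g 0) (applyUpTo-cong (λ i → f≗g (suc i)) l)

a≡s : ∀ n → a n ≡ s (2 ⊛ n) n
a≡s n = trans (cong sum (map-upTo (λ k → (2 ⊛ n ∸ 3 ⊛ k) C n) (suc (n / 3))))
  (sum-is-s (n / 3) (2 ⊛ n) n (≤-trans (m/n*n≤m n 3) (m≤m+n n (n ⊕ 0))) upper)
  where
  upper : 2 ⊛ n < (suc (n / 3) ⊛ 3) ⊕ n
  upper = subst (λ t → n ⊕ t < (suc (n / 3) ⊛ 3) ⊕ n) (sym (+-identityʳ n))
    (+-monoˡ-< n (subst (_< suc (n / 3) ⊛ 3) (sym (m≡m%n+[m/n]*n n 3))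
      (+-monoˡ-< (n / 3 ⊛ 3) (m%n<n n 3))))

-- The closed form of 3 a(n) + a(n-2) and the recurrence

-- 3 a(n) + a(n-2) = C(2n+2,n+1) - C(2n-1,n-2) for n = j + 2, with the
-- subtracted term moved to the left.
a-pair : ∀ j →
  3 ⊛ a (2 ⊕ j) ⊕ a j ⊕ ((3 ⊕ 2 ⊛ j) C j) ≡ (6 ⊕ 2 ⊛ j) C (3 ⊕ j)
a-pair j = begin
  3 ⊛ a (2 ⊕ j) ⊕ a j ⊕ x
    ≡⟨ cong₂ (λ u v → 3 ⊛ u ⊕ v ⊕ x) (a≡s (2 ⊕ j)) (a≡s j) ⟩
  3 ⊛ s (2 ⊛ (2 ⊕ j)) (2 ⊕ j) ⊕ s (2 ⊛ j) j ⊕ x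
    ≡⟨ cong (λ t → 3 ⊛ s t (2 ⊕ j) ⊕ s (2 ⊛ j) j ⊕ x) (*-distribˡ-+ 2 2 j) ⟩
  3 ⊛ s (4 ⊕ 2 ⊛ j) (2 ⊕ j) ⊕ s (2 ⊛ j) j ⊕ x
    ≡⟨ +-assoc (3 ⊛ s (4 ⊕ 2 ⊛ j) (2 ⊕ j)) (s (2 ⊛ j) j) x ⟩
  3 ⊛ s (4 ⊕ 2 ⊛ j) (2 ⊕ j) ⊕ (s (2 ⊛ j) j ⊕ x)
    ≡⟨ cong (3 ⊛ s (4 ⊕ 2 ⊛ j) (2 ⊕ j) ⊕_) (+-comm (s (2 ⊛ j) j) x) ⟩
  3 ⊛ s (4 ⊕ 2 ⊛ j) (2 ⊕ j) ⊕ s (3 ⊕ 2 ⊛ j) j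
    ≡⟨ s-relation (3 ⊕ 2 ⊛ j) j ⟩
  (6 ⊕ 2 ⊛ j) C (3 ⊕ j) ∎
  where
  open ≡-Reasoning
  x = (3 ⊕ 2 ⊛ j) C j

-- 2(n+1) (3 a(n) + a(n-2)) = (7n+5) C(2n,n) for n = j + 2.
a-pair-closed : ∀ j → 2 ⊛ (3 ⊕ j) ⊛ (3 ⊛ a (2 ⊕ j) ⊕ a j)
  ≡ (19 ⊕ 7 ⊛ j) ⊛ ((2 ⊛ (2 ⊕ j)) C (2 ⊕ j))
a-pair-closed j = +-cancelʳ-≡ (2 ⊛ ((3 ⊕ j) ⊛ x)) _ _ (begin
  2 ⊛ (3 ⊕ j) ⊛ b ⊕ 2 ⊛ ((3 ⊕ j) ⊛ x)
    ≡⟨ factor j b x ⟩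
  2 ⊛ ((3 ⊕ j) ⊛ (b ⊕ x))
    ≡⟨ cong (λ u → 2 ⊛ ((3 ⊕ j) ⊛ u)) (a-pair j) ⟩
  2 ⊛ ((3 ⊕ j) ⊛ ((6 ⊕ 2 ⊛ j) C (3 ⊕ j)))
    ≡⟨ cong (λ t → 2 ⊛ ((3 ⊕ j) ⊛ ((2 ⊕ t) C (3 ⊕ j)))) (*-distribˡ-+ 2 2 j) ⟨
  2 ⊛ ((3 ⊕ j) ⊛ ((2 ⊕ 2 ⊛ (2 ⊕ j)) C (3 ⊕ j)))
    ≡⟨ cong (2 ⊛_) (central-step (2 ⊕ j)) ⟩
  2 ⊛ (2 ⊛ ((1 ⊕ 2 ⊛ (2 ⊕ j)) ⊛ c))
    ≡⟨ cong (λ u → 2 ⊛ (2 ⊛ ((1 ⊕ 2 ⊛ (2 ⊕ j)) ⊛ u))) c≡2y ⟩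
  2 ⊛ (2 ⊛ ((1 ⊕ 2 ⊛ (2 ⊕ j)) ⊛ (2 ⊛ y)))
    ≡⟨ regroup j y ⟩
  (19 ⊕ 7 ⊛ j) ⊛ (2 ⊛ y) ⊕ 2 ⊛ (suc j ⊛ y)
    ≡⟨ cong₂ (λ u v → (19 ⊕ 7 ⊛ j) ⊛ u ⊕ 2 ⊛ v) (sym c≡2y) (odd-row-ratio j) ⟩
  (19 ⊕ 7 ⊛ j) ⊛ c ⊕ 2 ⊛ ((3 ⊕ j) ⊛ x) ∎)
  where
  open ≡-Reasoning
  b = 3 ⊛ a (2 ⊕ j) ⊕ a j
  c = (2 ⊛ (2 ⊕ j)) C (2 ⊕ j)
  x = (3 ⊕ 2 ⊛ j) C j
  y = (3 ⊕ 2 ⊛ j) C suc j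
  c≡2y : c ≡ 2 ⊛ y
  c≡2y = subst₂ (λ t u → t C (2 ⊕ j) ≡ 2 ⊛ (u C suc j))
    (sym (*-suc 2 (suc j))) (cong suc (*-suc 2 j)) (central-half (suc j))
  factor : ∀ j b x → 2 ⊛ (3 ⊕ j) ⊛ b ⊕ 2 ⊛ ((3 ⊕ j) ⊛ x) ≡ 2 ⊛ ((3 ⊕ j) ⊛ (b ⊕ x))
  factor = solve-∀
  regroup : ∀ j y → 2 ⊛ (2 ⊛ ((1 ⊕ 2 ⊛ (2 ⊕ j)) ⊛ (2 ⊛ y)))
    ≡ (19 ⊕ 7 ⊛ j) ⊛ (2 ⊛ y) ⊕ 2 ⊛ (suc j ⊛ y)
  regroup = solve-∀

-- The asserted recurrence for n = j + 3, as a first-order recurrence for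
-- 3 a(n) + a(n-2).
a-pair-step : ∀ j →
  (4 ⊕ j) ⊛ (19 ⊕ 7 ⊛ j) ⊛ (3 ⊛ a (3 ⊕ j) ⊕ a (1 ⊕ j))
    ≡ 2 ⊛ (26 ⊕ 7 ⊛ j) ⊛ (5 ⊕ 2 ⊛ j) ⊛ (3 ⊛ a (2 ⊕ j) ⊕ a j)
a-pair-step j = *-cancelˡ-≡ _ _ (2 ⊛ (3 ⊕ j)) (begin
  2 ⊛ (3 ⊕ j) ⊛ ((4 ⊕ j) ⊛ (19 ⊕ 7 ⊛ j) ⊛ b′)
    ≡⟨ isolate-b′ j b′ ⟩
  (3 ⊕ j) ⊛ (19 ⊕ 7 ⊛ j) ⊛ (2 ⊛ (4 ⊕ j) ⊛ b′)
    ≡⟨ cong ((3 ⊕ j) ⊛ (19 ⊕ 7 ⊛ j) ⊛_) (a-pair-closed (suc j)) ⟩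
  (3 ⊕ j) ⊛ (19 ⊕ 7 ⊛ j) ⊛ ((19 ⊕ 7 ⊛ suc j) ⊛ c′)
    ≡⟨ isolate-c′ j c′ ⟩
  (19 ⊕ 7 ⊛ j) ⊛ (26 ⊕ 7 ⊛ j) ⊛ ((3 ⊕ j) ⊛ c′)
    ≡⟨ cong ((19 ⊕ 7 ⊛ j) ⊛ (26 ⊕ 7 ⊛ j) ⊛_) step ⟩
  (19 ⊕ 7 ⊛ j) ⊛ (26 ⊕ 7 ⊛ j) ⊛ (2 ⊛ ((1 ⊕ 2 ⊛ (2 ⊕ j)) ⊛ c))
    ≡⟨ isolate-c j c ⟩
  2 ⊛ (26 ⊕ 7 ⊛ j) ⊛ (5 ⊕ 2 ⊛ j) ⊛ ((19 ⊕ 7 ⊛ j) ⊛ c)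
    ≡⟨ cong (2 ⊛ (26 ⊕ 7 ⊛ j) ⊛ (5 ⊕ 2 ⊛ j) ⊛_) (a-pair-closed j) ⟨
  2 ⊛ (26 ⊕ 7 ⊛ j) ⊛ (5 ⊕ 2 ⊛ j) ⊛ (2 ⊛ (3 ⊕ j) ⊛ b)
    ≡⟨ isolate-b j b ⟩
  2 ⊛ (3 ⊕ j) ⊛ (2 ⊛ (26 ⊕ 7 ⊛ j) ⊛ (5 ⊕ 2 ⊛ j) ⊛ b) ∎)
  where
  open ≡-Reasoning
  b  = 3 ⊛ a (2 ⊕ j) ⊕ a j
  b′ = 3 ⊛ a (3 ⊕ j) ⊕ a (1 ⊕ j)
  c  = (2 ⊛ (2 ⊕ j)) C (2 ⊕ j)
  c′ = (2 ⊛ (3 ⊕ j)) C (3 ⊕ j)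
  step : (3 ⊕ j) ⊛ c′ ≡ 2 ⊛ ((1 ⊕ 2 ⊛ (2 ⊕ j)) ⊛ c)
  step = trans (cong (λ t → (3 ⊕ j) ⊛ (t C (3 ⊕ j))) (*-suc 2 (2 ⊕ j)))
               (central-step (2 ⊕ j))
  isolate-b′ : ∀ j b → 2 ⊛ (3 ⊕ j) ⊛ ((4 ⊕ j) ⊛ (19 ⊕ 7 ⊛ j) ⊛ b)
    ≡ (3 ⊕ j) ⊛ (19 ⊕ 7 ⊛ j) ⊛ (2 ⊛ (4 ⊕ j) ⊛ b)
  isolate-b′ = solve-∀
  isolate-c′ : ∀ j c → (3 ⊕ j) ⊛ (19 ⊕ 7 ⊛ j) ⊛ ((19 ⊕ 7 ⊛ suc j) ⊛ c)
    ≡ (19 ⊕ 7 ⊛ j) ⊛ (26 ⊕ 7 ⊛ j) ⊛ ((3 ⊕ j) ⊛ c)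
  isolate-c′ = solve-∀
  isolate-c : ∀ j c → (19 ⊕ 7 ⊛ j) ⊛ (26 ⊕ 7 ⊛ j) ⊛ (2 ⊛ ((1 ⊕ 2 ⊛ (2 ⊕ j)) ⊛ c))
    ≡ 2 ⊛ (26 ⊕ 7 ⊛ j) ⊛ (5 ⊕ 2 ⊛ j) ⊛ ((19 ⊕ 7 ⊛ j) ⊛ c)
  isolate-c = solve-∀
  isolate-b : ∀ j b → 2 ⊛ (26 ⊕ 7 ⊛ j) ⊛ (5 ⊕ 2 ⊛ j) ⊛ (2 ⊛ (3 ⊕ j) ⊛ b)
    ≡ 2 ⊛ (3 ⊕ j) ⊛ (2 ⊛ (26 ⊕ 7 ⊛ j) ⊛ (5 ⊕ 2 ⊛ j) ⊛ b)
  isolate-b = solve-∀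

-- The left side of a-pair-step as an integer.
pos-lhs : ∀ j p q → + ((4 ⊕ j) ⊛ (19 ⊕ 7 ⊛ j) ⊛ (3 ⊛ p ⊕ q))
  ≡ (+ 4 + + j) * (+ 19 + + 7 * + j) * (+ 3 * + p + + q)
pos-lhs j p q = begin
  + ((4 ⊕ j) ⊛ (19 ⊕ 7 ⊛ j) ⊛ (3 ⊛ p ⊕ q))
    ≡⟨ pos-* ((4 ⊕ j) ⊛ (19 ⊕ 7 ⊛ j)) (3 ⊛ p ⊕ q) ⟩
  + ((4 ⊕ j) ⊛ (19 ⊕ 7 ⊛ j)) * (+ (3 ⊛ p) + + q)
    ≡⟨ cong₂ (λ u v → u * (v + + q)) (pos-* (4 ⊕ j) (19 ⊕ 7 ⊛ j)) (pos-* 3 p) ⟩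
  (+ 4 + + j) * (+ 19 + + (7 ⊛ j)) * (+ 3 * + p + + q)
    ≡⟨ cong (λ u → (+ 4 + + j) * (+ 19 + u) * (+ 3 * + p + + q)) (pos-* 7 j) ⟩
  (+ 4 + + j) * (+ 19 + + 7 * + j) * (+ 3 * + p + + q) ∎
  where open ≡-Reasoning

-- The right side of a-pair-step as an integer.
pos-rhs : ∀ j p q → + (2 ⊛ (26 ⊕ 7 ⊛ j) ⊛ (5 ⊕ 2 ⊛ j) ⊛ (3 ⊛ p ⊕ q))
  ≡ + 2 * (+ 26 + + 7 * + j) * (+ 5 + + 2 * + j) * (+ 3 * + p + + q)
pos-rhs j p q = begin
  + (2 ⊛ (26 ⊕ 7 ⊛ j) ⊛ (5 ⊕ 2 ⊛ j) ⊛ (3 ⊛ p ⊕ q))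
    ≡⟨ pos-* (2 ⊛ (26 ⊕ 7 ⊛ j) ⊛ (5 ⊕ 2 ⊛ j)) (3 ⊛ p ⊕ q) ⟩
  + (2 ⊛ (26 ⊕ 7 ⊛ j) ⊛ (5 ⊕ 2 ⊛ j)) * (+ (3 ⊛ p) + + q)
    ≡⟨ cong₂ (λ u v → u * (v + + q)) (pos-* (2 ⊛ (26 ⊕ 7 ⊛ j)) (5 ⊕ 2 ⊛ j)) (pos-* 3 p) ⟩
  + (2 ⊛ (26 ⊕ 7 ⊛ j)) * (+ 5 + + (2 ⊛ j)) * (+ 3 * + p + + q)
    ≡⟨ cong₂ (λ u v → u * (+ 5 + v) * (+ 3 * + p + + q)) (pos-* 2 (26 ⊕ 7 ⊛ j)) (pos-* 2 j) ⟩
  + 2 * (+ 26 + + (7 ⊛ j)) * (+ 5 + + 2 * + j) * (+ 3 * + p + + q)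
    ≡⟨ cong (λ u → + 2 * (+ 26 + u) * (+ 5 + + 2 * + j) * (+ 3 * + p + + q)) (pos-* 7 j) ⟩
  + 2 * (+ 26 + + 7 * + j) * (+ 5 + + 2 * + j) * (+ 3 * + p + + q) ∎
  where open ≡-Reasoning

-- The left side of the recurrence for n = j + 3 in terms of the combinations
-- 3 a(n) + a(n-2) and 3 a(n-1) + a(n-3).
recurrence-factors : ∀ (j p q r t : ℤ) →
    + 3 * (+ 3 + j + + 1) * (+ 7 * (+ 3 + j) - + 2) * p
    - + 6 * (+ 7 * (+ 3 + j) + + 5) * (+ 2 * (+ 3 + j) - + 1) * q
    + (+ 3 + j + + 1) * (+ 7 * (+ 3 + j) - + 2) * r
    - + 2 * (+ 7 * (+ 3 + j) + + 5) * (+ 2 * (+ 3 + j) - + 1) * t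
  ≡ (+ 4 + j) * (+ 19 + + 7 * j) * (+ 3 * p + r)
    - + 2 * (+ 26 + + 7 * j) * (+ 5 + + 2 * j) * (+ 3 * q + t)
recurrence-factors = ℤ-Solver.solve-∀

theorem7p2 : ∀ (n : ℕ) → 3 ≤ n →
    + 3 * (+ n + + 1) * (+ 7 * + n - + 2) * + a n
    - + 6 * (+ 7 * + n + + 5) * (+ 2 * + n - + 1) * + a (n ∸ 1)
    + (+ n + + 1) * (+ 7 * + n - + 2) * + a (n ∸ 2)
    - + 2 * (+ 7 * + n + + 5) * (+ 2 * + n - + 1) * + a (n ∸ 3)
    ≡ + 0
theorem7p2 (suc (suc (suc j))) (s≤s (s≤s (s≤s _))) =
  trans (recurrence-factors (+ j) (+ a (3 ⊕ j)) (+ a (2 ⊕ j)) (+ a (1 ⊕ j)) (+ a j))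
    (i≡j⇒i-j≡0
      (trans (sym (pos-lhs j (a (3 ⊕ j)) (a (1 ⊕ j))))
        (trans (cong +_ (a-pair-step j)) (pos-rhs j (a (2 ⊕ j)) (a j)))))
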